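{- Let $\Sigma$ be a signature, $T$ the effect-tree monad over $\Sigma$, and let $\mathcal{E}\subseteq (T\mathbb{N})^2$ be a reflexive, transitive and compositional algebraic relation. Then for any two choice functions $c,d:[\mathcal{E}_0]\to T\mathbf{0}$, the maps $\alpha_c,\alpha_d:T[\mathcal{E}_0]\to[\mathcal{E}_0]$ are equal.
   Context: A signature $\Sigma$ is a set of operators with arities in $\mathbb{N}\cup\{\mathbb{N}\}$. For a set $X$, $TX$ is the set of possibly infinite-depth trees with leaves $\bot$, $\top$, or $\langle x\rangle$ ($x\in X$), and internal nodes labelled by operators $\sigma$ with $|\sigma|$ children (indexed by $\mathbb{N}$ if $|\sigma|=\mathbb{N}$). $T$ is a functor ($Tf$ relabels leaves $\langle x\rangle\mapsto\langle f(x)\rangle$) and a monad with $\eta(x)=\langle x\rangle$ and $\mu:TTX\to TX$ replacing each leaf $\langle t\rangle$ by the subtree $t$; for $f:X\to TY$, $f^*:=\mu\circ Tf$. Let $\mathbf{0}=\emptyset\subseteq\mathbb{N}$, so $T\mathbf{0}\subseteq T\mathbb{N}$ consists of trees whose only leaves are $\bot,\top$. An algebraic relation is $\mathcal{E}\subseteq(T\mathbb{N})^2$; write $a\,\mathcal{E}\,b$ for $(a,b)\in\mathcal{E}$. It is reflexive if $a\,\mathcal{E}\,a$ for all $a$; transitive as usual; compositional if whenever $a\,\mathcal{E}\,b$ and $f,g:\mathbb{N}\to T\mathbb{N}$ satisfy $f(n)\,\mathcal{E}\,g(n)$ for all $n$, then $f^*(a)\,\mathcal{E}\,g^*(b)$.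 Let $\mathcal{E}_0=\mathcal{E}\cap(T\mathbf{0})^2$. For $a\in T\mathbf{0}$ let $[a]=\{b\in T\mathbf{0}\mid a\,\mathcal{E}_0\,b\text{ and }b\,\mathcal{E}_0\,a\}$, and the value space is $[\mathcal{E}_0]=\{[a]\mid a\in T\mathbf{0}\}$, with $[-]:T\mathbf{0}\to[\mathcal{E}_0]$, $a\mapsto[a]$. A choice function is $c:[\mathcal{E}_0]\to T\mathbf{0}$ with $c(S)\in S$ for all $S$. Define $\alpha_c:=[-]\circ\mu_{\mathbf{0}}\circ Tc : T[\mathcal{E}_0]\to[\mathcal{E}_0]$. -}

module Defs where

open import Level using (Level; _⊔_; suc; zero)
open import Data.Nat using (ℕ; _<_)
open import Data.List using (List; []; _∷_)
open import Data.Unit using (⊤; tt)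
open import Data.Empty using (⊥; ⊥-elim)
open import Data.Product using (Σ; ∃; _×_; _,_; proj₁; proj₂)
open import Function using (_∘_; id)
open import Function.Bundles using (_⇔_; mk⇔; Equivalence)
open import Relation.Binary.PropositionalEquality using (_≡_; refl; subst; sym)

data Arity : Set where
  fin : ℕ → Arity
  nat : Arity

IsPos : Arity → ℕ → Set
IsPos (fin n) i = i < n
IsPos nat     i = ⊤

record Signature : Set₁ where
  field
    Op    : Set
    arity : Op → Arity

-- Agda's --safe forbids --guardedness here, so a tree is represented, as in
-- the set-theoretic reading, by its labelling of nodes: a map from finite
-- paths (lists of child indices, read from the root) to node labels, where
-- `none` marks paths that do not exist in the tree, subject to the evident
-- well-formedness condition.

module Trees (Sig : Signature) where
  open Signature Sig

  private variable
    a b : Level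
    X Y : Set a

  Path : Set
  Path = List ℕ

  data Label (X : Set a) : Set a where
    bot  : Label X
    top  : Label X
    leaf : X → Label X
    op   : Op → Label X
    none : Label X

  Def : Label X → Set
  Def none = ⊥
  Def _    = ⊤

  ChildOK : Label X → ℕ → Set
  ChildOK (op σ) i = IsPos (arity σ) i
  ChildOK _      i = ⊥

  Valid : (Path → Label X) → Path → Set
  Valid f []      = ⊤
  Valid f (i ∷ p) = ChildOK (f []) i × Valid (f ∘ (i ∷_)) p

  WellFormed : (Path → Label X) → Set
  WellFormed f = ∀ p → Def (f p) ⇔ Valid f p

  record Tree (X : Set a) : Set a where
    constructor mkTree
    field
      label : Path → Label X
      wf    : WellFormed label
  open Tree public

  _≋_ : Tree X → Tree X → Set _
  s ≋ t = ∀ p → label s p ≡ label t p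

  private
    ⇔-trans : ∀ {ℓ₁ ℓ₂ ℓ₃} {A : Set ℓ₁} {B : Set ℓ₂} {C : Set ℓ₃} →
              A ⇔ B → B ⇔ C → A ⇔ C
    ⇔-trans f g = mk⇔ (Equivalence.to g ∘ Equivalence.to f)
                      (Equivalence.from f ∘ Equivalence.from g)

  mapL : (X → Y) → Label X → Label Y
  mapL f bot      = bot
  mapL f top      = top
  mapL f (leaf x) = leaf (f x)
  mapL f (op σ)   = op σ
  mapL f none     = none

  private
    def-mapL : (f : X → Y) (l : Label X) → Def (mapL f l) ⇔ Def l
    def-mapL f bot      = mk⇔ id id
    def-mapL f top      = mk⇔ id id
    def-mapL f (leaf x) = mk⇔ id id
    def-mapL f (op σ)   = mk⇔ id id
    def-mapL f none     = mk⇔ id id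

    child-mapL : (f : X → Y) (l : Label X) (i : ℕ) → ChildOK (mapL f l) i ⇔ ChildOK l i
    child-mapL f bot      i = mk⇔ id id
    child-mapL f top      i = mk⇔ id id
    child-mapL f (leaf x) i = mk⇔ id id
    child-mapL f (op σ)   i = mk⇔ id id
    child-mapL f none     i = mk⇔ id id

    valid-map : (f : X → Y) (F : Path → Label X) → ∀ p →
                Valid (mapL f ∘ F) p ⇔ Valid F p
    valid-map f F []      = mk⇔ id id
    valid-map f F (i ∷ p) =
      let c = child-mapL f (F []) i
          v = valid-map f (F ∘ (i ∷_)) p
      in mk⇔ (λ (x , y) → Equivalence.to c x , Equivalence.to v y)
             (λ (x , y) → Equivalence.from c x , Equivalence.from v y)

  mapT : (X → Y) → Tree X → Tree Y
  label (mapT f t) = mapL f ∘ label t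
  wf    (mapT f t) p =
    ⇔-trans (def-mapL f (label t p))
      (⇔-trans (wf t p) (mk⇔ (Equivalence.from (valid-map f (label t) p))
                             (Equivalence.to   (valid-map f (label t) p))))

  -- μ : T T X → T X, replacing each leaf ⟨s⟩ by the subtree s

  joinL : Label (Tree X) → (Path → Label (Tree X)) → Path → Label X
  joinL bot      F []      = bot
  joinL top      F []      = top
  joinL (leaf s) F p       = label s p
  joinL (op σ)   F []      = op σ
  joinL none     F []      = none
  joinL bot      F (i ∷ p) = none
  joinL top      F (i ∷ p) = none
  joinL (op σ)   F (i ∷ p) = joinL (F (i ∷ [])) (F ∘ (i ∷_)) p
  joinL none     F (i ∷ p) = none

  private
    ⊥⇔ : ∀ {ℓ₁ ℓ₂} {A : Set ℓ₁} {B : Set ℓ₂} → (A → ⊥) → (B → ⊥) → A ⇔ B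
    ⊥⇔ na nb = mk⇔ (⊥-elim ∘ na) (⊥-elim ∘ nb)

    join-root : (l : Label (Tree X)) (F : Path → Label (Tree X)) →
                ∀ p → Def (joinL l F p) → Def l
    join-root bot      F p d = tt
    join-root top      F p d = tt
    join-root (leaf s) F p d = tt
    join-root (op σ)   F p d = tt
    join-root none     F [] d = d
    join-root none     F (i ∷ p) d = d

    join-wf : (l : Label (Tree X)) (F : Path → Label (Tree X)) →
              l ≡ F [] → WellFormed F → ∀ p →
              Def (joinL l F p) ⇔ Valid (joinL l F) p
    join-wf bot      F e w []      = mk⇔ id id
    join-wf top      F e w []      = mk⇔ id id
    join-wf (leaf s) F e w p       = wf s p
    join-wf (op σ)   F e w []      = mk⇔ id id
    join-wf none     F e w []      =
      ⊥-elim (subst Def (sym e) (Equivalence.from (w []) tt))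
    join-wf bot      F e w (i ∷ p) = ⊥⇔ id proj₁
    join-wf top      F e w (i ∷ p) = ⊥⇔ id proj₁
    join-wf none     F e w (i ∷ p) = ⊥⇔ id proj₁
    join-wf {X = X} (op σ) F e w (i ∷ p) = goal
      where
      F′ : Path → Label (Tree X)
      F′ = F ∘ (i ∷_)
      wf′ : IsPos (arity σ) i → WellFormed F′
      wf′ ip q = mk⇔
        (λ d → proj₂ (Equivalence.to (w (i ∷ q)) d))
        (λ v → Equivalence.from (w (i ∷ q)) (subst (λ l → ChildOK l i) e ip , v))
      goal : Def (joinL (F′ []) F′ p) ⇔ (IsPos (arity σ) i × Valid (λ q → joinL (op σ) F (i ∷ q)) p)
      goal = mk⇔
        (λ d → let ip = helper d in
           ip , Equivalence.to (join-wf (F′ []) F′ refl (wf′ ip) p) d)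
        (λ (ip , v) → Equivalence.from (join-wf (F′ []) F′ refl (wf′ ip) p) v)
        where
        helper : Def (joinL (F′ []) F′ p) → IsPos (arity σ) i
        helper d = subst (λ l → ChildOK l i) (sym e)
          (proj₁ (Equivalence.to (w (i ∷ [])) (join-root (F′ []) F′ p d)))

  μ : Tree (Tree X) → Tree X
  label (μ t) = joinL (label t []) (label t)
  wf    (μ t) = join-wf (label t []) (label t) refl (wf t)

  _* : (X → Tree Y) → Tree X → Tree Y
  f * = μ ∘ mapT f

  T𝟎 : Set
  T𝟎 = Tree ⊥

  inc : T𝟎 → Tree ℕ
  inc = mapT ⊥-elim

module Relations (Sig : Signature) {ℓ : Level}
                 (ℰ : Trees.Tree Sig ℕ → Trees.Tree Sig ℕ → Set ℓ) where
  open Trees Sig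

  IsReflexive : Set ℓ
  IsReflexive = ∀ a → ℰ a a

  IsTransitive : Set ℓ
  IsTransitive = ∀ {a b c} → ℰ a b → ℰ b c → ℰ a c

  IsCompositional : Set ℓ
  IsCompositional = ∀ {a b} (f g : ℕ → Tree ℕ) →
    ℰ a b → (∀ n → ℰ (f n) (g n)) → ℰ ((f *) a) ((g *) b)

  -- ℰ is a relation on trees, so it cannot distinguish equal trees; with
  -- trees represented by labellings, equality of trees is ≋.
  RespectsTreeEq : Set ℓ
  RespectsTreeEq = ∀ {a a′ b b′} → a ≋ a′ → b ≋ b′ → ℰ a b → ℰ a′ b′

  ℰ₀ : T𝟎 → T𝟎 → Set ℓ
  ℰ₀ a b = ℰ (inc a) (inc b)

  classOf : T𝟎 → T𝟎 → Set ℓ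
  classOf a b = ℰ₀ a b × ℰ₀ b a

  record Value : Set (suc ℓ) where
    field
      carrier : T𝟎 → Set ℓ
      isClass : ∃ λ a → ∀ b → carrier b ⇔ classOf a b
  open Value public

  _≐_ : Value → Value → Set ℓ
  S ≐ S′ = ∀ b → carrier S b ⇔ carrier S′ b

  [_] : T𝟎 → Value
  carrier [ a ] = classOf a
  isClass [ a ] = a , λ b → mk⇔ id id

  record ChoiceFunction : Set (suc ℓ) where
    field
      choose : Value → T𝟎
      chosen : ∀ S → carrier S (choose S)
  open ChoiceFunction public

  α : ChoiceFunction → Tree Value → Value
  α c = [_] ∘ μ ∘ mapT (choose c)

module Submission where

-- Fix t ∈ T[ℰ₀].  Number the leaves of t by (a code of) their
-- paths; this gives a single tree a ∈ Tℕ that does not depend on any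
-- choice.  For a choice function c let f_c : ℕ → Tℕ send the number of
-- a leaf [S] of t to the representative c(S) (and everything else to the
-- tree ⊥).  Then f_c*(a) is μ(Tc t), viewed in Tℕ.  For two choice
-- functions c, d the representatives c(S), d(S) lie in the same class,
-- so f_c(n) ℰ f_d(n) for all n; reflexivity (a ℰ a) and compositionality
-- give μ(Tc t) ℰ₀ μ(Td t), and symmetrically.  Transitivity then turns
-- this into equality of the classes α_c(t) and α_d(t).

open import Level using (Level; _⊔_)
open import Data.Nat using (ℕ; zero; suc)
open import Data.Nat.Binary using (ℕᵇ; zero; 2[1+_]; 1+[2_]; toℕ; fromℕ)
open import Data.Nat.Binary.Properties using (fromℕ-toℕ)
open import Data.List using (List; []; _∷_)
open import Data.Product using (_,_; proj₁; proj₂; _×_)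
open import Data.Empty using (⊥-elim)
open import Function using (_∘_; id)
open import Function.Bundles using (_⇔_; mk⇔; Equivalence)
open import Relation.Binary.PropositionalEquality
  using (_≡_; refl; sym; trans; cong; cong₂; subst)
open import Defs

private variable
  a b c : Level

-- Paths are numbered through binary expansions: a bit string
-- 1ˣ⁰ 0 1ˣ¹ 0 … reads as the list x₀ ∷ x₁ ∷ …, and bit strings are the
-- bijective binary numerals ℕᵇ ≅ ℕ.
module PathCode where

  -- increase the first entry (the effect of a leading bit 1)
  bumpHead : List ℕ → List ℕ
  bumpHead []      = []
  bumpHead (x ∷ p) = suc x ∷ p

  -- read a numeral as a bit string: 2[1+_] is a bit 1, 1+[2_] a bit 0
  decodeᵇ : ℕᵇ → List ℕ
  decodeᵇ zero      = []
  decodeᵇ 2[1+ s ]  = bumpHead (decodeᵇ s)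
  decodeᵇ 1+[2 s ]  = 0 ∷ decodeᵇ s

  ones : ℕ → ℕᵇ → ℕᵇ
  ones zero    s = s
  ones (suc x) s = 2[1+ ones x s ]

  encodeᵇ : List ℕ → ℕᵇ
  encodeᵇ []      = zero
  encodeᵇ (x ∷ p) = ones x 1+[2 encodeᵇ p ]

  decode-ones : ∀ x p → decodeᵇ (ones x 1+[2 encodeᵇ p ]) ≡ x ∷ decodeᵇ (encodeᵇ p)
  decode-ones zero    p = refl
  decode-ones (suc x) p = cong bumpHead (decode-ones x p)

  decodeᵇ-encodeᵇ : ∀ p → decodeᵇ (encodeᵇ p) ≡ p
  decodeᵇ-encodeᵇ []      = refl
  decodeᵇ-encodeᵇ (x ∷ p) = trans (decode-ones x p) (cong (x ∷_) (decodeᵇ-encodeᵇ p))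

  decodePath : ℕ → List ℕ
  decodePath = decodeᵇ ∘ fromℕ

  encodePath : List ℕ → ℕ
  encodePath = toℕ ∘ encodeᵇ

  decode-encode : ∀ p → decodePath (encodePath p) ≡ p
  decode-encode p = trans (cong decodeᵇ (fromℕ-toℕ (encodeᵇ p))) (decodeᵇ-encodeᵇ p)

module TreeFacts (Sig : Signature) where
  open Trees Sig

  private variable
    X : Set a
    Y : Set b
    Z : Set c

  botTree : Tree X
  label botTree []      = bot
  label botTree (_ ∷ _) = none
  wf botTree []      = mk⇔ id id
  wf botTree (_ ∷ _) = mk⇔ ⊥-elim proj₁

  def-mapL : (g : X → Y) (l : Label X) → Def (mapL g l) ≡ Def l
  def-mapL g bot      = refl
  def-mapL g top      = refl
  def-mapL g (leaf x) = refl
  def-mapL g (op σ)   = refl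
  def-mapL g none     = refl

  childOK-mapL : (g : X → Y) (l : Label X) (i : ℕ) → ChildOK (mapL g l) i ≡ ChildOK l i
  childOK-mapL g bot      i = refl
  childOK-mapL g top      i = refl
  childOK-mapL g (leaf x) i = refl
  childOK-mapL g (op σ)   i = refl
  childOK-mapL g none     i = refl

  valid-mapL : (g : Path → X → Y) (F : Path → Label X) →
               ∀ p → Valid (λ q → mapL (g q) (F q)) p ≡ Valid F p
  valid-mapL g F []      = refl
  valid-mapL g F (i ∷ p) =
    cong₂ _×_ (childOK-mapL (g []) (F []) i) (valid-mapL (g ∘ (i ∷_)) (F ∘ (i ∷_)) p)

  relabelLeaves : (Path → Y) → Tree X → Tree Y
  label (relabelLeaves e t) q = mapL (λ _ → e q) (label t q)
  wf (relabelLeaves e t) p =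
    subst (_⇔ Valid (label (relabelLeaves e t)) p) (sym (def-mapL (λ _ → e p) (label t p)))
      (subst (Def (label t p) ⇔_) (sym (valid-mapL (λ q _ → e q) (label t) p))
        (wf t p))

  -- naturality of Kleisli extension: T k ∘ h* = (T k ∘ h)*, at label level
  mapL-joinL : (h : X → Tree Y) (k : Y → Z) (l : Label X) (F : Path → Label X) →
               ∀ p → mapL k (joinL (mapL h l) (mapL h ∘ F) p)
                   ≡ joinL (mapL (mapT k ∘ h) l) (mapL (mapT k ∘ h) ∘ F) p
  mapL-joinL h k bot      F []      = refl
  mapL-joinL h k top      F []      = refl
  mapL-joinL h k (op σ)   F []      = refl
  mapL-joinL h k none     F []      = refl
  mapL-joinL h k bot      F (i ∷ p) = refl
  mapL-joinL h k top      F (i ∷ p) = refl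
  mapL-joinL h k none     F (i ∷ p) = refl
  mapL-joinL h k (op σ)   F (i ∷ p) = mapL-joinL h k (F (i ∷ [])) (F ∘ (i ∷_)) p
  mapL-joinL h k (leaf x) F p       = refl

  map-bind : (h : X → Tree Y) (k : Y → Z) (t : Tree X) →
             mapT k ((h *) t) ≋ ((mapT k ∘ h) *) t
  map-bind h k t = mapL-joinL h k (label t []) (label t)

  LeavesAgree : {X : Set a} {Z : Set c} (f : Y → Tree Z) (h : X → Tree Z) (e : Path → Y) → (Path → Label X) → Set (a ⊔ c)
  LeavesAgree f h e F = ∀ q x → F q ≡ leaf x → f (e q) ≡ h x

  joinL-relabel : (f : Y → Tree Z) (h : X → Tree Z) (e : Path → Y) (F : Path → Label X) →
                  LeavesAgree f h e F →
                  ∀ p → joinL (mapL f (mapL (λ _ → e []) (F []))) (λ q → mapL f (mapL (λ _ → e q) (F q))) p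
                      ≡ joinL (mapL h (F [])) (mapL h ∘ F) p
  joinL-relabel f h e F agree p with F [] in root
  joinL-relabel f h e F agree []      | bot    = refl
  joinL-relabel f h e F agree []      | top    = refl
  joinL-relabel f h e F agree []      | op σ   = refl
  joinL-relabel f h e F agree []      | none   = refl
  joinL-relabel f h e F agree (i ∷ p) | bot    = refl
  joinL-relabel f h e F agree (i ∷ p) | top    = refl
  joinL-relabel f h e F agree (i ∷ p) | none   = refl
  joinL-relabel f h e F agree (i ∷ p) | op σ   =
    joinL-relabel f h (e ∘ (i ∷_)) (F ∘ (i ∷_)) (λ q → agree (i ∷ q)) p
  joinL-relabel f h e F agree p       | leaf x = cong (λ s → label s p) (agree [] x root)

  bind-relabel : (f : Y → Tree Z) (h : X → Tree Z) (e : Path → Y) (t : Tree X) →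
                 LeavesAgree f h e (label t) → (f *) (relabelLeaves e t) ≋ (h *) t
  bind-relabel f h e t = joinL-relabel f h e (label t)

  -- Any bind h* t can be computed by a map ℕ → T Y from the tree
  -- numbering t's leaves by their paths: read the leaf off the decoded
  -- path, and use a default tree where there is no leaf.
  open PathCode

  numbering : Tree X → Tree ℕ
  numbering = relabelLeaves encodePath

  atLeaf : (X → Tree Y) → Tree Y → Label X → Tree Y
  atLeaf h default (leaf x) = h x
  atLeaf h default _        = default

  reindex : Tree X → (X → Tree Y) → Tree Y → ℕ → Tree Y
  reindex t h default = atLeaf h default ∘ label t ∘ decodePath

  bind-numbering : (t : Tree X) (h : X → Tree Y) (default : Tree Y) →
                   (reindex t h default *) (numbering t) ≋ (h *) t
  bind-numbering t h default = bind-relabel (reindex t h default) h encodePath t agree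
    where
    agree : LeavesAgree (reindex t h default) h encodePath (label t)
    agree q x leaf-at-q =
      cong (atLeaf h default) (trans (cong (label t) (decode-encode q)) leaf-at-q)

module Independence (Sig : Signature) {ℓ : Level}
    (ℰ : Trees.Tree Sig ℕ → Trees.Tree Sig ℕ → Set ℓ)
    (resp : Relations.RespectsTreeEq Sig ℰ)
    (refl-ℰ : Relations.IsReflexive Sig ℰ)
    (trans-ℰ : Relations.IsTransitive Sig ℰ)
    (comp-ℰ : Relations.IsCompositional Sig ℰ) where
  open Trees Sig
  open Relations Sig ℰ
  open TreeFacts Sig

  representatives-related : (S : Value) {x y : T𝟎} → carrier S x → carrier S y → ℰ₀ x y
  representatives-related S x∈S y∈S with isClass S
  ... | _ , class = trans-ℰ (proj₂ (Equivalence.to (class _) x∈S))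
                            (proj₁ (Equivalence.to (class _) y∈S))

  flatten : ChoiceFunction → Tree Value → T𝟎
  flatten ch t = μ (mapT (choose ch) t)

  representative : ChoiceFunction → Tree Value → ℕ → Tree ℕ
  representative ch t = reindex t (inc ∘ choose ch) botTree

  -- f_c(n) ℰ f_d(n): both are representatives of the same class, or both ⊥
  representative-related : (c d : ChoiceFunction) (t : Tree Value) →
                           ∀ n → ℰ (representative c t n) (representative d t n)
  representative-related c d t n with label t (PathCode.decodePath n)
  ... | bot    = refl-ℰ _
  ... | top    = refl-ℰ _
  ... | op σ   = refl-ℰ _
  ... | none   = refl-ℰ _
  ... | leaf S = representatives-related S (chosen c S) (chosen d S)

  bind-representative : (ch : ChoiceFunction) (t : Tree Value) →
                        (representative ch t *) (numbering t) ≋ inc (flatten ch t)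
  bind-representative ch t p =
    trans (bind-numbering t (inc ∘ choose ch) botTree p)
          (sym (map-bind (choose ch) ⊥-elim t p))

  flatten-related : (c d : ChoiceFunction) (t : Tree Value) →
                    ℰ₀ (flatten c t) (flatten d t)
  flatten-related c d t =
    resp (bind-representative c t) (bind-representative d t)
         (comp-ℰ (representative c t) (representative d t)
                 (refl-ℰ (numbering t)) (representative-related c d t))

  class-eq : (x y : T𝟎) → ℰ₀ x y → ℰ₀ y x → [ x ] ≐ [ y ]
  class-eq x y xy yx _ = mk⇔ (λ (xb , bx) → trans-ℰ yx xb , trans-ℰ bx xy)
                             (λ (yb , by) → trans-ℰ xy yb , trans-ℰ by yx)

mainTheorem4 : (Sig : Signature) {ℓ : Level}
    (ℰ : Trees.Tree Sig ℕ → Trees.Tree Sig ℕ → Set ℓ) →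
    Relations.RespectsTreeEq Sig ℰ →
    Relations.IsReflexive Sig ℰ →
    Relations.IsTransitive Sig ℰ →
    Relations.IsCompositional Sig ℰ →
    (c d : Relations.ChoiceFunction Sig ℰ) →
    (t : Trees.Tree Sig (Relations.Value Sig ℰ)) →
    Relations._≐_ Sig ℰ (Relations.α Sig ℰ c t) (Relations.α Sig ℰ d t)
mainTheorem4 Sig ℰ resp refl-ℰ trans-ℰ comp-ℰ c d t =
  class-eq (flatten c t) (flatten d t) (flatten-related c d t) (flatten-related d c t)
  where open Independence Sig ℰ resp refl-ℰ trans-ℰ comp-ℰ
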